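{- For every integer $n\geq 2$, $$p(n)=n+\sum_{k=3}^{n}(n-k+1)\gamma(k)=n+(n-2)\gamma(3)+(n-3)\gamma(4)+\cdots+2\gamma(n-1)+\gamma(n),$$ where the sum is empty (equal to $0$) if $n=2$.
   Context: $p(n)$ is the number of integer partitions of $n$. A nuclear partition is an integer partition with no part equal to $1$. $\gamma(n)$ denotes the number of nuclear partitions $\mu=(\mu_1,\mu_2,\dots,\mu_r)$ of $n$, with $\mu_1\geq\mu_2\geq\dots\geq\mu_r\geq2$ and $r\geq2$, such that $\mu_1=\mu_2$ (so the two largest parts are equal); $\gamma(0):=0$, and $\gamma(1)=\gamma(2)=\gamma(3)=0$. -}

module Defs where

open import Data.Empty using (⊥)
open import Data.List.Base using (List; []; _∷_; _++_; map; filter; length; applyUpTo)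
open import Data.List.Membership.Propositional using (_∈_; _∉_)
open import Data.List.Membership.Propositional.Properties
  using (∈-map⁺; ∈-map⁻; ∈-++⁺ˡ; ∈-++⁺ʳ; ∈-++⁻; ∈-filter⁺; ∈-filter⁻)
open import Data.List.Properties using (∷-injectiveʳ)
open import Data.List.Relation.Unary.All using (All; []; _∷_)
open import Data.List.Relation.Unary.AllPairs using ([]; _∷_)
open import Data.List.Relation.Unary.Any using (here)
open import Data.List.Relation.Unary.Linked using (Linked; linked?)
open import Data.List.Relation.Unary.Unique.Propositional using (Unique)
import Data.List.Relation.Unary.Unique.Propositional.Properties as Unique
open import Data.Nat.Base using (ℕ; zero; suc; _+_; _∸_; _≤_; _≥_; z≤n; s≤s)
open import Data.Nat.ListAction using (sum)
open import Data.Nat.Properties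
open import Data.List.Membership.DecPropositional _≟_ using (_∉?_)
open import Data.Product.Base using (_×_; _,_)
open import Data.Sum.Base using (inj₁; inj₂)
open import Relation.Binary.PropositionalEquality
open import Relation.Nullary.Decidable using (yes; no; _×-dec_)
open import Relation.Unary using (Decidable)

record IsPartition (n : ℕ) (μ : List ℕ) : Set where
  constructor isPartition
  field
    decreasing : Linked _≥_ μ
    positive   : All (1 ≤_) μ
    total      : sum μ ≡ n

Nuclear : List ℕ → Set
Nuclear μ = 1 ∉ μ

-- At least two parts, and the first two (the largest ones, when the list is
-- weakly decreasing) are equal.
TopTwoEqual : List ℕ → Set
TopTwoEqual []          = ⊥
TopTwoEqual (_ ∷ [])    = ⊥
TopTwoEqual (a ∷ b ∷ _) = a ≡ b

nuclear? : Decidable Nuclear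
nuclear? μ = 1 ∉? μ

topTwoEqual? : Decidable TopTwoEqual
topTwoEqual? []          = no λ ()
topTwoEqual? (_ ∷ [])    = no λ ()
topTwoEqual? (a ∷ b ∷ _) = a ≟ b

-- compositionsFrom a k lists the nonempty sequences of positive integers with
-- sum a + k and first entry at least a (for a ≥ 1): the first entry is either
-- larger than a, or equal to a and followed by a composition of k.
compositionsFrom : ℕ → ℕ → List (List ℕ)
compositionsFrom a zero    = (a ∷ []) ∷ []
compositionsFrom a (suc k) =
  compositionsFrom (suc a) k ++ map (a ∷_) (compositionsFrom 1 k)

compositions : ℕ → List (List ℕ)
compositions zero    = [] ∷ []
compositions (suc k) = compositionsFrom 1 k

-- Every partition of n, once each: see ∈-partitions⁻, ∈-partitions⁺ and
-- partitions-unique below.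
partitions : ℕ → List (List ℕ)
partitions n = filter (linked? _≥?_) (compositions n)

p : ℕ → ℕ
p n = length (partitions n)

γ : ℕ → ℕ
γ n = length (filter (λ μ → nuclear? μ ×-dec topTwoEqual? μ) (partitions n))

-- ∑[ k from a to b ] f k, with both endpoints included; 0 when b < a.
sumFromTo : ℕ → ℕ → (ℕ → ℕ) → ℕ
sumFromTo a b f = sum (applyUpTo (λ i → f (a + i)) (suc b ∸ a))

infix 5 sumFromTo
syntax sumFromTo a b (λ k → e) = ∑[ k from a to b ] e

∈-compositionsFrom⁻ : ∀ a k {μ} → 1 ≤ a → μ ∈ compositionsFrom a k →
                      All (1 ≤_) μ × sum μ ≡ a + k
∈-compositionsFrom⁻ a zero    1≤a (here refl) = 1≤a ∷ [] , refl
∈-compositionsFrom⁻ a (suc k) 1≤a μ∈ with ∈-++⁻ (compositionsFrom (suc a) k) μ∈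
... | inj₁ q = let pos , eq = ∈-compositionsFrom⁻ (suc a) k (s≤s z≤n) q
               in pos , trans eq (sym (+-suc a k))
... | inj₂ q with ∈-map⁻ (a ∷_) q
...   | _ , r , refl = let pos , eq = ∈-compositionsFrom⁻ 1 k (s≤s z≤n) r
                       in 1≤a ∷ pos , cong (a +_) eq

∈-compositionsFrom⁺ : ∀ a k {x xs} → a ≤ x → All (1 ≤_) (x ∷ xs) →
                      sum (x ∷ xs) ≡ a + k → (x ∷ xs) ∈ compositionsFrom a k
∈-compositionsFrom⁺ a zero {x} {[]} a≤x _ eq =
  here (cong (_∷ []) (trans (sym (+-identityʳ x)) (trans eq (+-identityʳ a))))
∈-compositionsFrom⁺ a zero {x} {y ∷ ys} a≤x (_ ∷ 1≤y ∷ _) eq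
  with () ← <-irrefl (sym (trans eq (+-identityʳ a)))
              (≤-trans (≤-reflexive (+-comm 1 a))
                       (+-mono-≤ a≤x (≤-trans 1≤y (m≤m+n y (sum ys)))))
∈-compositionsFrom⁺ a (suc k) {x} {xs} a≤x pos eq with a ≟ x
... | no a≢x = ∈-++⁺ˡ
  (∈-compositionsFrom⁺ (suc a) k (≤∧≢⇒< a≤x a≢x) pos (trans eq (+-suc a k)))
∈-compositionsFrom⁺ a (suc k) {xs = []} a≤x pos eq | yes refl
  with () ← +-cancelˡ-≡ a 0 (suc k) eq
∈-compositionsFrom⁺ a (suc k) {xs = _ ∷ _} a≤x (_ ∷ pos@(1≤y ∷ _)) eq | yes refl =
  ∈-++⁺ʳ (compositionsFrom (suc a) k)
    (∈-map⁺ (a ∷_) (∈-compositionsFrom⁺ 1 k 1≤y pos (+-cancelˡ-≡ a _ _ eq)))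

compositionsFrom-head : ∀ a k {x xs} → (x ∷ xs) ∈ compositionsFrom a k → a ≤ x
compositionsFrom-head a zero    (here refl) = ≤-refl
compositionsFrom-head a (suc k) μ∈ with ∈-++⁻ (compositionsFrom (suc a) k) μ∈
... | inj₁ q = <⇒≤ (compositionsFrom-head (suc a) k q)
... | inj₂ q with ∈-map⁻ (a ∷_) q
...   | _ , _ , refl = ≤-refl

compositionsFrom-unique : ∀ a k → Unique (compositionsFrom a k)
compositionsFrom-unique a zero    = [] ∷ []
compositionsFrom-unique a (suc k) = Unique.++⁺
  (compositionsFrom-unique (suc a) k)
  (Unique.map⁺ ∷-injectiveʳ (compositionsFrom-unique 1 k))
  λ (l , r) → disjoint l (∈-map⁻ (a ∷_) r)
  where
  disjoint : ∀ {μ} → μ ∈ compositionsFrom (suc a) k → _ → ⊥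
  disjoint l (_ , _ , refl) = <-irrefl refl (compositionsFrom-head (suc a) k l)

∈-partitions⁻ : ∀ n {μ} → μ ∈ partitions n → IsPartition n μ
∈-partitions⁻ n μ∈ with ∈-filter⁻ (linked? _≥?_) {xs = compositions n} μ∈
∈-partitions⁻ zero    μ∈ | here refl , dec = isPartition dec [] refl
∈-partitions⁻ (suc k) μ∈ | q , dec =
  let pos , eq = ∈-compositionsFrom⁻ 1 k (s≤s z≤n) q in isPartition dec pos eq

∈-partitions⁺ : ∀ n {μ} → IsPartition n μ → μ ∈ partitions n
∈-partitions⁺ n (isPartition dec pos eq) =
  ∈-filter⁺ (linked? _≥?_) (∈-compositions n pos eq) dec
  where
  ∈-compositions : ∀ n {μ} → All (1 ≤_) μ → sum μ ≡ n → μ ∈ compositions n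
  ∈-compositions zero    []              eq = here refl
  ∈-compositions zero    (s≤s _ ∷ _)     ()
  ∈-compositions (suc k) pos@(1≤x ∷ _)   eq = ∈-compositionsFrom⁺ 1 k 1≤x pos eq

partitions-unique : ∀ n → Unique (partitions n)
partitions-unique n = Unique.filter⁺ (linked? _≥?_) (compositions-unique n)
  where
  compositions-unique : ∀ n → Unique (compositions n)
  compositions-unique zero    = [] ∷ []
  compositions-unique (suc k) = compositionsFrom-unique 1 k

{-# OPTIONS --safe #-}
-- Appending a part 1 is a bijection from the partitions of n onto the
-- non-nuclear partitions of n + 1, so p (n + 1) = p n + ν (n + 1), where ν n
-- counts the nuclear partitions of n. For n ≥ 2, increasing the largest part by
-- one is a bijection from the nuclear partitions of n onto the nuclear
-- partitions of n + 1 whose two largest parts are not equal, so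
-- ν (n + 1) = ν n + γ (n + 1). The formula is this recurrence summed twice.
module Submission where

open import Defs
open import Data.Nat.Base using (ℕ; _+_; _*_; _∸_; _≤_)
open import Relation.Binary.PropositionalEquality using (_≡_)

open import Data.List.Base using (List; []; _∷_; _++_; _∷ʳ_; map; filter; length; applyUpTo)
open import Data.List.Membership.Propositional using (_∈_)
open import Data.List.Membership.Propositional.Properties
  using (∈-map⁺; ∈-map⁻; ∈-++⁺ˡ; ∈-++⁺ʳ; ∈-++⁻; ∈-filter⁺; ∈-filter⁻)
open import Data.List.Membership.Propositional.Properties.WithK using (unique∧set⇒bag)
open import Data.List.Properties using (length-++; length-map; ∷ʳ-injectiveˡ)
open import Data.List.Relation.Binary.BagAndSetEquality using (∼bag⇒↭)
open import Data.List.Relation.Binary.Disjoint.Propositional using (Disjoint)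
open import Data.List.Relation.Binary.Permutation.Propositional.Properties using (↭-length)
open import Data.List.Relation.Unary.All using (All; []; _∷_)
import Data.List.Relation.Unary.All.Properties as All
open import Data.List.Relation.Unary.Any using (here; there)
open import Data.List.Relation.Unary.Linked using (Linked; []; [-]; _∷_)
open import Data.List.Relation.Unary.Unique.Propositional using (Unique)
import Data.List.Relation.Unary.Unique.Propositional.Properties as Unique
open import Data.Nat.Base using (zero; suc; _≥_; z≤n; s≤s)
open import Data.Nat.ListAction using (sum)
open import Data.Nat.ListAction.Properties using (sum-++)
open import Data.Nat.Properties
open import Data.Nat.Tactic.RingSolver using (solve-∀)
open import Data.List.Membership.DecPropositional _≟_ using (_∈?_)
open import Data.Product.Base using (_×_; _,_; ∃-syntax; proj₁; proj₂)
open import Data.Sum.Base using (inj₁; inj₂)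
open import Function.Base using (_∘_)
open import Function.Bundles using (mk⇔)
open import Function.Definitions using (Injective)
open import Relation.Binary.PropositionalEquality
  using (refl; sym; trans; cong; cong₂; module ≡-Reasoning)
open import Relation.Nullary.Decidable using (yes; no; _×-dec_)
open import Relation.Nullary.Negation using (¬_)

-- Duplicate-free lists with the same members are permutations of each other, so they have equal
-- length. This reduces both counting recurrences to membership arguments.
length-map-++-unique : ∀ {A B : Set} {f : A → B} {xs ys zs} → Injective _≡_ _≡_ f →
                       Unique xs → Unique ys → Unique zs → Disjoint (map f xs) ys →
                       (∀ {z} → z ∈ zs → z ∈ map f xs ++ ys) →
                       (∀ {z} → z ∈ map f xs ++ ys → z ∈ zs) →
                       length zs ≡ length xs + length ys
length-map-++-unique {f = f} {xs} {ys} {zs} inj xs! ys! zs! disj to from = begin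
  length zs                    ≡⟨ ↭-length (∼bag⇒↭ (unique∧set⇒bag zs!
                                    (Unique.++⁺ (Unique.map⁺ inj xs!) ys! disj) (mk⇔ to from))) ⟩
  length (map f xs ++ ys)      ≡⟨ length-++ (map f xs) ⟩
  length (map f xs) + length ys ≡⟨ cong (_+ length ys) (length-map f xs) ⟩
  length xs + length ys        ∎
  where open ≡-Reasoning

nuclearPartitions : ℕ → List (List ℕ)
nuclearPartitions n = filter nuclear? (partitions n)

nuclearPartitions-unique : ∀ n → Unique (nuclearPartitions n)
nuclearPartitions-unique n = Unique.filter⁺ nuclear? (partitions-unique n)

ν : ℕ → ℕ
ν n = length (nuclearPartitions n)

-- Parts equal to 1

∷ʳ1-decreasing : ∀ {μ} → Linked _≥_ μ → All (1 ≤_) μ → Linked _≥_ (μ ∷ʳ 1)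
∷ʳ1-decreasing []        _          = [-]
∷ʳ1-decreasing [-]       (1≤x ∷ _)  = 1≤x ∷ [-]
∷ʳ1-decreasing (x≥y ∷ l) (_ ∷ pos)  = x≥y ∷ ∷ʳ1-decreasing l pos

Linked-++⁻ˡ : ∀ {A : Set} {R : A → A → Set} xs {ys} → Linked R (xs ++ ys) → Linked R xs
Linked-++⁻ˡ []           _         = []
Linked-++⁻ˡ (_ ∷ [])     _         = [-]
Linked-++⁻ˡ (_ ∷ y ∷ xs) (Rxy ∷ l) = Rxy ∷ Linked-++⁻ˡ (y ∷ xs) l

sum-∷ʳ1 : ∀ μ → sum (μ ∷ʳ 1) ≡ suc (sum μ)
sum-∷ʳ1 μ = trans (sum-++ μ (1 ∷ [])) (+-comm (sum μ) 1)

-- In a weakly decreasing list of positive numbers, everything after a 1 is again 1, so the last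
-- part is 1.
1∈⇒∷ʳ1 : ∀ {μ} → Linked _≥_ μ → All (1 ≤_) μ → 1 ∈ μ → ∃[ κ ] μ ≡ κ ∷ʳ 1
1∈⇒∷ʳ1 [-] _ (here refl) = [] , refl
1∈⇒∷ʳ1 {x ∷ _} (_ ∷ l) (_ ∷ pos) (there 1∈) =
  let κ , eq = 1∈⇒∷ʳ1 l pos 1∈ in x ∷ κ , cong (x ∷_) eq
1∈⇒∷ʳ1 (1≥y ∷ l) (_ ∷ pos@(1≤y ∷ _)) (here refl) =
  let κ , eq = 1∈⇒∷ʳ1 l pos (here (≤-antisym 1≤y 1≥y)) in 1 ∷ κ , cong (1 ∷_) eq

∷ʳ1⁺ : ∀ {n μ} → IsPartition n μ → IsPartition (suc n) (μ ∷ʳ 1)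
∷ʳ1⁺ {μ = μ} (isPartition l pos eq) = isPartition
  (∷ʳ1-decreasing l pos) (All.∷ʳ⁺ pos ≤-refl) (trans (sum-∷ʳ1 μ) (cong suc eq))

∷ʳ1⁻ : ∀ {n} μ → IsPartition (suc n) (μ ∷ʳ 1) → IsPartition n μ
∷ʳ1⁻ μ (isPartition l pos eq) = isPartition
  (Linked-++⁻ˡ μ l) (All.++⁻ˡ μ pos) (suc-injective (trans (sym (sum-∷ʳ1 μ)) eq))

p-suc : ∀ n → p (suc n) ≡ p n + ν (suc n)
p-suc n = length-map-++-unique (∷ʳ-injectiveˡ _ _)
  (partitions-unique n) (nuclearPartitions-unique (suc n)) (partitions-unique (suc n))
  disjoint to from
  where
  disjoint : Disjoint (map (_∷ʳ 1) (partitions n)) (nuclearPartitions (suc n))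
  disjoint (l , r) with ∈-map⁻ (_∷ʳ 1) l
  ... | κ , _ , refl = proj₂ (∈-filter⁻ nuclear? {xs = partitions (suc n)} r)
                         (∈-++⁺ʳ κ (here refl))

  to : ∀ {μ} → μ ∈ partitions (suc n) →
       μ ∈ map (_∷ʳ 1) (partitions n) ++ nuclearPartitions (suc n)
  to {μ} μ∈ with 1 ∈? μ
  ... | no 1∉ = ∈-++⁺ʳ (map (_∷ʳ 1) (partitions n)) (∈-filter⁺ nuclear? μ∈ 1∉)
  ... | yes 1∈ with ∈-partitions⁻ (suc n) μ∈
  ...   | π@(isPartition l pos _) with 1∈⇒∷ʳ1 l pos 1∈
  ...     | κ , refl = ∈-++⁺ˡ (∈-map⁺ (_∷ʳ 1) (∈-partitions⁺ n (∷ʳ1⁻ κ π)))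

  from : ∀ {μ} → μ ∈ map (_∷ʳ 1) (partitions n) ++ nuclearPartitions (suc n) →
         μ ∈ partitions (suc n)
  from μ∈ with ∈-++⁻ (map (_∷ʳ 1) (partitions n)) μ∈
  ... | inj₂ r = proj₁ (∈-filter⁻ nuclear? r)
  ... | inj₁ l with ∈-map⁻ (_∷ʳ 1) l
  ...   | _ , κ∈ , refl = ∈-partitions⁺ (suc n) (∷ʳ1⁺ (∈-partitions⁻ n κ∈))

-- The largest part of a nuclear partition

IsNuclearPartition : ℕ → List ℕ → Set
IsNuclearPartition n μ = IsPartition n μ × Nuclear μ

∈-nuclearPartitions⁻ : ∀ n {μ} → μ ∈ nuclearPartitions n → IsNuclearPartition n μ
∈-nuclearPartitions⁻ n μ∈ =
  let μ∈p , nuc = ∈-filter⁻ nuclear? {xs = partitions n} μ∈ in ∈-partitions⁻ n μ∈p , nuc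

∈-nuclearPartitions⁺ : ∀ n {μ} → IsNuclearPartition n μ → μ ∈ nuclearPartitions n
∈-nuclearPartitions⁺ n (π , nuc) = ∈-filter⁺ nuclear? (∈-partitions⁺ n π) nuc

-- The value at `[]` keeps the map injective on all lists; it is only applied to partitions of
-- positive numbers, which are nonempty.
sucHead : List ℕ → List ℕ
sucHead []       = []
sucHead (x ∷ xs) = suc x ∷ xs

sucHead-injective : Injective _≡_ _≡_ sucHead
sucHead-injective {[]}    {[]}    _    = refl
sucHead-injective {_ ∷ _} {_ ∷ _} refl = refl

sucHead-nuclear⁺ : ∀ {n μ} → IsNuclearPartition (suc n) μ →
                   IsNuclearPartition (suc (suc n)) (sucHead μ)
sucHead-nuclear⁺ (isPartition [-] (1≤x ∷ []) eq , nuc) =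
  isPartition [-] (s≤s z≤n ∷ []) (cong suc eq) , λ { (here refl) → <-irrefl refl 1≤x }
sucHead-nuclear⁺ (isPartition (x≥y ∷ l) (1≤x ∷ pos) eq , nuc) =
  isPartition (m≤n⇒m≤1+n x≥y ∷ l) (s≤s z≤n ∷ pos) (cong suc eq) ,
  λ { (here refl) → <-irrefl refl 1≤x ; (there 1∈) → nuc (there 1∈) }

-- The first part is already at least the second, so raising it makes it strictly larger.
sucHead-¬topTwoEqual : ∀ {μ} → Linked _≥_ μ → ¬ TopTwoEqual (sucHead μ)
sucHead-¬topTwoEqual (x≥y ∷ _) refl = <-irrefl refl x≥y

-- The bound 3 ≤ n excludes the partition (2) of 2, which comes from the
-- non-nuclear partition (1).
sucHead-nuclear⁻ : ∀ {n μ} → IsNuclearPartition (3 + n) μ → ¬ TopTwoEqual μ →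
                   ∃[ κ ] μ ≡ sucHead κ × IsNuclearPartition (2 + n) κ
-- A single part must be `3 + n`, so its preimage is the single part `2 + n`, which is not 1.
sucHead-nuclear⁻ {n} (isPartition [-] _ eq , _) _
  with refl ← trans (sym (+-identityʳ _)) eq =
  (2 + n) ∷ [] , refl ,
  isPartition [-] (s≤s z≤n ∷ []) (suc-injective eq) , λ { (here ()) ; (there ()) }
sucHead-nuclear⁻ {μ = suc x ∷ y ∷ μ} (isPartition (x≥y ∷ l) (_ ∷ pos@(1≤y ∷ _)) eq , nuc) x≢y =
  x ∷ y ∷ μ , refl ,
  isPartition (y≤x ∷ l) (≤-trans 1≤y y≤x ∷ pos) (suc-injective eq) ,
  -- If lowering the first part gave 1, then `y ≤ 1` would make the second part 1, which `nuc`
  -- forbids.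
  λ { (here refl) → nuc (there (here (≤-antisym 1≤y y≤x))) ; (there 1∈) → nuc (there 1∈) }
  where
  y≤x : y ≤ x
  y≤x = ≤-pred (≤∧≢⇒< x≥y (x≢y ∘ sym))
sucHead-nuclear⁻ {μ = zero ∷ _ ∷ _} (isPartition _ (() ∷ _) _ , _) _

-- The offset matters: `ν 2` is 1, while `ν 1 + γ 2` is 0.
ν-suc : ∀ n → ν (3 + n) ≡ ν (2 + n) + γ (3 + n)
ν-suc n = length-map-++-unique sucHead-injective
  (nuclearPartitions-unique (2 + n))
  (Unique.filter⁺ nuclearTopTwoEqual? (partitions-unique (3 + n)))
  (nuclearPartitions-unique (3 + n))
  disjoint to from
  where
  nuclearTopTwoEqual? = λ μ → nuclear? μ ×-dec topTwoEqual? μ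

  raised topTwoEqual : List (List ℕ)
  raised      = map sucHead (nuclearPartitions (2 + n))
  topTwoEqual = filter nuclearTopTwoEqual? (partitions (3 + n))

  disjoint : Disjoint raised topTwoEqual
  disjoint (l , r) with ∈-map⁻ sucHead l
  ... | κ , κ∈ , refl = sucHead-¬topTwoEqual
    (IsPartition.decreasing (proj₁ (∈-nuclearPartitions⁻ (2 + n) κ∈)))
    (proj₂ (proj₂ (∈-filter⁻ nuclearTopTwoEqual? {xs = partitions (3 + n)} r)))

  to : ∀ {μ} → μ ∈ nuclearPartitions (3 + n) → μ ∈ raised ++ topTwoEqual
  to {μ} μ∈ with topTwoEqual? μ | ∈-filter⁻ nuclear? {xs = partitions (3 + n)} μ∈
  ... | yes t | μ∈p , nuc = ∈-++⁺ʳ raised (∈-filter⁺ nuclearTopTwoEqual? μ∈p (nuc , t))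
  ... | no ¬t | _ with sucHead-nuclear⁻ (∈-nuclearPartitions⁻ (3 + n) μ∈) ¬t
  ...   | κ , refl , π = ∈-++⁺ˡ (∈-map⁺ sucHead (∈-nuclearPartitions⁺ (2 + n) π))

  from : ∀ {μ} → μ ∈ raised ++ topTwoEqual → μ ∈ nuclearPartitions (3 + n)
  from μ∈ with ∈-++⁻ raised μ∈
  ... | inj₂ r = let μ∈p , nuc , _ = ∈-filter⁻ nuclearTopTwoEqual? {xs = partitions (3 + n)} r
                 in ∈-filter⁺ nuclear? μ∈p nuc
  ... | inj₁ l with ∈-map⁻ sucHead l
  ...   | _ , κ∈ , refl = ∈-nuclearPartitions⁺ (3 + n)
                            (sucHead-nuclear⁺ (∈-nuclearPartitions⁻ (2 + n) κ∈))

-- Double summation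

∑ : (ℕ → ℕ) → ℕ → ℕ
∑ g m = sum (applyUpTo g m)

-- This is the sum of the partial sums `∑ g j` for `1 ≤ j ≤ m`: the term `g i` occurs in those with
-- `i < j`, which are `m ∸ suc i + 1` many.
∑∑ : (ℕ → ℕ) → ℕ → ℕ
∑∑ g m = sum (applyUpTo (λ i → (m ∸ suc i + 1) * g i) m)

∑-suc : ∀ g m → ∑ g (suc m) ≡ ∑ g m + g m
∑-suc g zero    = +-identityʳ (g 0)
∑-suc g (suc m) = trans (cong (g 0 +_) (∑-suc (g ∘ suc) m)) (sym (+-assoc (g 0) _ _))

∑∑-suc : ∀ g m → ∑∑ g (suc m) ≡ ∑∑ g m + ∑ g (suc m)
∑∑-suc g zero    = cong (_+ 0) (*-identityˡ (g 0))
-- Sums unfold from the first term, and the remaining terms form the same double sum for the shifted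
-- function `g ∘ suc`.
∑∑-suc g (suc m) = trans
  (cong ((suc m + 1) * g 0 +_) (∑∑-suc (g ∘ suc) m))
  (regroup m (g 0) (∑∑ (g ∘ suc) m) (∑ (g ∘ suc) (suc m)))
  where
  regroup : ∀ m a t s → (suc m + 1) * a + (t + s) ≡ ((m + 1) * a + t) + (a + s)
  regroup = solve-∀

ν-sum : ∀ m → ν (2 + m) ≡ 1 + ∑ (λ i → γ (3 + i)) m
-- The constant 1 is `ν 2`, which counts the partition (2) alone.
ν-sum zero    = refl
ν-sum (suc m) = begin
  ν (3 + m)                                  ≡⟨ ν-suc m ⟩
  ν (2 + m) + γ (3 + m)                      ≡⟨ cong (_+ γ (3 + m)) (ν-sum m) ⟩
  1 + (∑ (λ i → γ (3 + i)) m + γ (3 + m))    ≡⟨ cong suc (∑-suc (λ i → γ (3 + i)) m) ⟨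
  1 + ∑ (λ i → γ (3 + i)) (suc m)            ∎
  where open ≡-Reasoning

-- The summand `2 + m` collects `p 2`, which is 2, and the constant 1 from `ν-sum` at each of the
-- `m` steps.
p-sum : ∀ m → p (2 + m) ≡ 2 + m + ∑∑ (λ i → γ (3 + i)) m
p-sum zero    = refl
p-sum (suc m) = begin
  p (3 + m)                                 ≡⟨ p-suc (2 + m) ⟩
  p (2 + m) + ν (3 + m)                     ≡⟨ cong₂ _+_ (p-sum m) (ν-sum (suc m)) ⟩
  (2 + m + ∑∑ g m) + (1 + ∑ g (suc m))      ≡⟨ regroup m (∑∑ g m) (∑ g (suc m)) ⟩
  3 + m + (∑∑ g m + ∑ g (suc m))            ≡⟨ cong (3 + m +_) (∑∑-suc g m) ⟨
  3 + m + ∑∑ g (suc m)                      ∎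
  where
  open ≡-Reasoning
  g : ℕ → ℕ
  g i = γ (3 + i)
  regroup : ∀ m t s → (2 + m + t) + (1 + s) ≡ 3 + m + (t + s)
  regroup = solve-∀

mainTheorem4 : (n : ℕ) → 2 ≤ n →
    p n ≡ n + (∑[ k from 3 to n ] ((n ∸ k + 1) * γ k))
-- For `n = 2 + m` and `k = 3 + i`, the weight `n ∸ k + 1` computes to `m ∸ suc i + 1` and the
-- number of terms to `m`, so the two sums agree by definition.
mainTheorem4 (suc (suc m)) _ = p-sum m
mainTheorem4 (suc zero) (s≤s ())
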